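{- Let $G$ be a connected graph with $n>1$ vertices of tree-depth $\mathrm{td}$. Then, for all $s\in V(G)$, it holds that $b(G,s)\ge n^{1/\mathrm{td}}/\mathrm{td}$.
   Context: All graphs are finite, undirected and loopless. Telephone model: at the start exactly one vertex, the source $s$, is informed; in each round every informed vertex may send the message to at most one of its uninformed neighbors, which is informed by the end of that round. For a connected graph $G$ and $s\in V(G)$, $b(G,s)$ is the minimum number of rounds needed to inform all vertices of $G$ starting from $s$. The tree-depth of a connected graph is the minimum height (number of vertices on a longest root-to-leaf path) of a rooted tree on the same vertex set in which any two vertices adjacent in the graph are in an ancestor/descendant relation; a single vertex has tree-depth $1$. -}

module Defs where

open import Data.Fin using (Fin)
open import Data.Fin.Subset using (Subset; ⁅_⁆; ⊤; _∈_; _∉_)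
open import Data.List using (List; []; _∷_; _++_; allFin)
import Data.List.Membership.Propositional as List
open import Data.List.Relation.Binary.Permutation.Propositional using (_↭_)
open import Data.List.Relation.Unary.Any using (Any)
open import Data.Maybe using (Maybe; just)
open import Data.Nat using (ℕ; zero; suc; _≤_; _⊔_)
open import Data.Product using (∃-syntax; _×_)
open import Data.Sum using (_⊎_)
open import Function.Bundles using (_⇔_)
open import Relation.Binary.Construct.Closure.ReflexiveTransitive using (Star)
open import Relation.Binary.Definitions using (Decidable; Symmetric; Irreflexive)
open import Relation.Binary.PropositionalEquality using (_≡_)

IsMinimum : (ℕ → Set) → ℕ → Set
IsMinimum P k = P k × (∀ m → P m → k ≤ m)

record Graph (n : ℕ) : Set₁ where
  field
    Adj        : Fin n → Fin n → Set
    adj?       : Decidable Adj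
    adj-sym    : Symmetric Adj
    adj-irrefl : Irreflexive _≡_ Adj

open Graph public

Connected : ∀ {n} → Graph n → Set
Connected G = ∀ u v → Star (Adj G) u v

-- call u ≡ just v means that u sends the message to v in this round; as call
-- is a function, u calls at most one vertex.
record Round {n} (G : Graph n) (before after : Subset n) : Set where
  field
    call       : Fin n → Maybe (Fin n)
    call-valid : ∀ {u v} → call u ≡ just v → u ∈ before × v ∉ before × Adj G u v
    informed   : ∀ v → v ∈ after ⇔ (v ∈ before ⊎ (∃[ u ] call u ≡ just v))

-- Reachable G s t I: some choice of calls makes I exactly the set of informed
-- vertices after t rounds from source s.
data Reachable {n} (G : Graph n) (s : Fin n) : ℕ → Subset n → Set where
  start : Reachable G s 0 ⁅ s ⁆
  step  : ∀ {t I J} → Reachable G s t I → Round G I J → Reachable G s (suc t) J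

BroadcastsIn : ∀ {n} → Graph n → Fin n → ℕ → Set
BroadcastsIn G s t = Reachable G s t ⊤

-- b(G,s) ≡ b
IsBroadcastTime : ∀ {n} → Graph n → Fin n → ℕ → Set
IsBroadcastTime G s = IsMinimum (BroadcastsIn G s)

-- Data.Tree.Rose relies on sized types and so is not available under --safe.
data RootedTree (A : Set) : Set where
  node : A → List (RootedTree A) → RootedTree A

module _ {A : Set} where

  vertices  : RootedTree A → List A
  verticesˢ : List (RootedTree A) → List A
  vertices (node x ts) = x ∷ verticesˢ ts
  verticesˢ []         = []
  verticesˢ (t ∷ ts)   = vertices t ++ verticesˢ ts

  -- The number of vertices, not edges, on a longest root-to-leaf path.
  height  : RootedTree A → ℕ
  heightˢ : List (RootedTree A) → ℕ
  height (node x ts) = suc (heightˢ ts)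
  heightˢ []         = zero
  heightˢ (t ∷ ts)   = height t ⊔ heightˢ ts

  -- x is an ancestor of y, where each vertex is an ancestor of itself.
  data Ancestor (x y : A) : RootedTree A → Set where
    root  : ∀ {ts} → y List.∈ vertices (node x ts) → Ancestor x y (node x ts)
    below : ∀ {z ts} → Any (Ancestor x y) ts → Ancestor x y (node z ts)

-- The permutation says that every vertex of G labels exactly one tree node.
record IsTreeDepthTree {n} (G : Graph n) (T : RootedTree (Fin n)) : Set where
  field
    spanning   : vertices T ↭ allFin n
    comparable : ∀ {u v} → Adj G u v → Ancestor u v T ⊎ Ancestor v u T

IsTreeDepth : ∀ {n} → Graph n → ℕ → Set
IsTreeDepth G = IsMinimum (λ h → ∃[ T ] (IsTreeDepthTree G T × height T ≡ h))

{-# OPTIONS --safe #-}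

-- Let every vertex but s have as parent the vertex that called it; each vertex
-- has at most b children.  For a subtree T of the elimination tree, call the
-- vertices of T whose parent lies outside T (or that have no parent) the entries
-- of T.  Following parents backwards from any vertex of T shows that there is an
-- entry, and deleting the root of T creates at most b new ones.  By induction
-- |T| ≤ e · (1 + (1 + b) + … + (1 + b)^(h − 1)), where e ≥ 1 is the number of
-- entries and h the height of T; the whole tree has the single entry s.
module Submission where

open import Defs
open import Data.Empty using (⊥-elim)
open import Data.Fin using (Fin; zero; suc; _≟_)
open import Data.Fin.Subset using (Subset; ⁅_⁆; _∉_) renaming (_∈_ to _∈ˢ_)
open import Data.Fin.Subset.Properties using (_∈?_; ∈⊤; x∈⁅y⁆⇒x≡y)
import Data.Fin.Properties as Fin
open import Data.List using (List; []; _∷_; _++_; length; filter; allFin)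
open import Data.List.Membership.Propositional using (_∈_; lose)
open import Data.List.Membership.Propositional.Properties using (∈-++⁺ˡ; ∈-++⁺ʳ)
import Data.List.Membership.DecPropositional as DecMembership
open import Data.List.Properties using (length-++; filter-++; filter-none; filter-some; length-tabulate)
open import Data.List.Relation.Binary.Permutation.Propositional using (↭-sym; ↭⇒↭ₛ)
open import Data.List.Relation.Binary.Permutation.Propositional.Properties using (↭-length)
import Data.List.Relation.Binary.Permutation.Setoid.Properties as PermutationSetoid
open import Data.List.Relation.Unary.All as All
open import Data.List.Relation.Unary.Any using (Any; here; there)
open import Data.List.Relation.Unary.Unique.Propositional using (Unique; []; _∷_)
open import Data.List.Relation.Unary.Unique.Propositional.Properties using (allFin⁺)
open import Data.Maybe using (Maybe; just; nothing)
import Data.Maybe.Properties as Maybe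
import Data.Maybe.Relation.Unary.All as Maybe
open import Data.Nat using (ℕ; zero; suc; _≤_; _<_; _+_; _*_; _^_; _⊔_; z≤n; s≤s)
open import Data.Nat.Induction using (<-wellFounded)
open import Data.Nat.Properties hiding (_≟_)
open import Data.Nat.Tactic.RingSolver using (solve-∀)
open import Data.Product using (∃-syntax; _×_; _,_; proj₁; proj₂)
open import Data.Sum as Sum using (_⊎_; inj₁; inj₂)
open import Function.Bundles using (module Equivalence)
open import Induction.WellFounded using (Acc; acc)
open import Relation.Binary.PropositionalEquality
open import Relation.Nullary using (¬_; yes; no; contradiction)
open import Relation.Unary using (Decidable)

-- Counting in lists, and membership in rooted trees.

module _ {A : Set} where

  count : {P : A → Set} → Decidable P → List A → ℕ
  count P? xs = length (filter P? xs)

  count-++ : {P : A → Set} (P? : Decidable P) (xs ys : List A) →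
             count P? (xs ++ ys) ≡ count P? xs + count P? ys
  count-++ P? xs ys = trans (cong length (filter-++ P? xs ys)) (length-++ (filter P? xs))

  count-∷-≤ : {P : A → Set} (P? : Decidable P) (x : A) (xs : List A) →
              count P? xs ≤ count P? (x ∷ xs)
  count-∷-≤ P? x xs with P? x
  ... | yes _ = n≤1+n _
  ... | no  _ = ≤-refl

  count-⊎ : {P Q R : A → Set} (P? : Decidable P) (Q? : Decidable Q) (R? : Decidable R) →
            (∀ {x} → P x → Q x ⊎ R x) →
            ∀ xs → count P? xs ≤ count Q? xs + count R? xs
  count-⊎ P? Q? R? f []       = z≤n
  count-⊎ P? Q? R? f (x ∷ xs) with count-⊎ P? Q? R? f xs | P? x | Q? x | R? x
  ... | ih | no  _ | no  _ | no  _ = ih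
  ... | ih | no  _ | yes _ | no  _ = m≤n⇒m≤1+n ih
  ... | ih | no  _ | no  _ | yes _ = ≤-trans ih (+-monoʳ-≤ _ (n≤1+n _))
  ... | ih | no  _ | yes _ | yes _ = m≤n⇒m≤1+n (≤-trans ih (+-monoʳ-≤ _ (n≤1+n _)))
  ... | ih | yes _ | yes _ | no  _ = s≤s ih
  ... | ih | yes _ | yes _ | yes _ = s≤s (≤-trans ih (+-monoʳ-≤ _ (n≤1+n _)))
  ... | ih | yes _ | no  _ | yes _ = ≤-trans (s≤s ih) (≤-reflexive (sym (+-suc _ _)))
  ... | ih | yes p | no ¬q | no ¬r = ⊥-elim (Sum.[ ¬q , ¬r ] (f p))

  -- Serves twice: for the single vertex that `u` calls in a round, and for the single entry of the
  -- whole tree.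
  count-subsingleton : {P : A → Set} (P? : Decidable P) → (∀ {x y} → P x → P y → x ≡ y) →
                       ∀ {xs} → Unique xs → count P? xs ≤ 1
  count-subsingleton P? P-irr []                      = z≤n
  count-subsingleton P? P-irr {x ∷ xs} (x∉xs ∷ xs!) with P? x
  ... | no  _ = count-subsingleton P? P-irr xs!
  ... | yes p = s≤s (≤-reflexive (cong length
                  (filter-none P? (All.map (λ x≢y q → x≢y (P-irr p q)) x∉xs))))

  Unique-++⁻ : ∀ xs {ys : List A} → Unique (xs ++ ys) →
               Unique xs × Unique ys × (∀ {x} → x ∈ xs → ¬ x ∈ ys)
  Unique-++⁻ []       ys!         = [] , ys! , λ ()
  Unique-++⁻ (x ∷ xs) (x∉ ∷ xsys!) with Unique-++⁻ xs xsys!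
  ... | xs! , ys! , disj =
    All.tabulate (λ y∈xs → All.lookup x∉ (∈-++⁺ˡ y∈xs)) ∷ xs! , ys! , λ where
      (here refl)  x∈ys → All.lookup x∉ (∈-++⁺ʳ xs x∈ys) refl
      (there y∈xs) y∈ys → disj y∈xs y∈ys

  ancestor-∈ : ∀ {x y T} → Ancestor {A} x y T → x ∈ vertices T
  ancestor-∈ˢ : ∀ {x y ts} → Any (Ancestor {A} x y) ts → x ∈ verticesˢ ts
  ancestor-∈ (root _)   = here refl
  ancestor-∈ (below as) = there (ancestor-∈ˢ as)
  ancestor-∈ˢ (here a)               = ∈-++⁺ˡ (ancestor-∈ a)
  ancestor-∈ˢ {ts = t ∷ _} (there as) = ∈-++⁺ʳ (vertices t) (ancestor-∈ˢ as)

  descendant-∈ : ∀ {x y T} → Ancestor {A} x y T → y ∈ vertices T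
  descendant-∈ˢ : ∀ {x y ts} → Any (Ancestor {A} x y) ts → y ∈ verticesˢ ts
  descendant-∈ (root y∈)  = y∈
  descendant-∈ (below as) = there (descendant-∈ˢ as)
  descendant-∈ˢ (here a)               = ∈-++⁺ˡ (descendant-∈ a)
  descendant-∈ˢ {ts = t ∷ _} (there as) = ∈-++⁺ʳ (vertices t) (descendant-∈ˢ as)

-- Broadcast trees, built round by round.

isChildOf? : ∀ {n} (parent : Fin n → Maybe (Fin n)) (u : Fin n) →
             Decidable (λ v → parent v ≡ just u)
isChildOf? parent u v = Maybe.≡-dec _≟_ (parent v) (just u)

-- `rank` stands for the round in which a vertex is informed; its decrease along parents makes
-- following them terminate. `parent-informed` and `rank-≤` keep `rank-<` true when a round is
-- added.
record BroadcastTree {n} (G : Graph n) (s : Fin n) (t : ℕ) (I : Subset n) : Set where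
  field
    parent          : Fin n → Maybe (Fin n)
    rank            : Fin n → ℕ
    parent-adj      : ∀ {u v} → parent v ≡ just u → Adj G u v
    parent-informed : ∀ {u v} → parent v ≡ just u → u ∈ˢ I
    rank-<          : ∀ {u v} → parent v ≡ just u → rank u < rank v
    rank-≤          : ∀ {v} → v ∈ˢ I → rank v ≤ t
    orphan          : ∀ {v} → v ∈ˢ I → parent v ≡ nothing → v ≡ s
    children-≤      : ∀ u {vs} → Unique vs → count (isChildOf? parent u) vs ≤ t

module _ {n} {G : Graph n} {s : Fin n} where

  module Extend {t I J} (B : BroadcastTree G s t I) (R : Round G I J) where
    open BroadcastTree B
    open Round R

    -- Several vertices may call `v` in the same round; one of them is chosen.
    caller : Fin n → Maybe (Fin n)
    caller v with Fin.any? (λ u → Maybe.≡-dec _≟_ (call u) (just v))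
    ... | yes (u , _) = just u
    ... | no  _       = nothing

    caller-just : ∀ {u v} → caller v ≡ just u → call u ≡ just v
    caller-just {v = v} eq with Fin.any? (λ u → Maybe.≡-dec _≟_ (call u) (just v))
    caller-just refl | yes (_ , c) = c

    caller-nothing : ∀ {u v} → caller v ≡ nothing → ¬ call u ≡ just v
    caller-nothing {v = v} eq c with Fin.any? (λ u → Maybe.≡-dec _≟_ (call u) (just v))
    ... | no ¬c = ¬c (_ , c)

    parent′ : Fin n → Maybe (Fin n)
    parent′ v with v ∈? I
    ... | yes _ = parent v
    ... | no  _ = caller v

    -- Vertices that stay uninformed also get `suc t`; each further round overwrites this value
    -- until they are informed.
    rank′ : Fin n → ℕ
    rank′ v with v ∈? I
    ... | yes _ = rank v
    ... | no  _ = suc t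

    rank′-old : ∀ {v} → v ∈ˢ I → rank′ v ≡ rank v
    rank′-old {v} v∈I with v ∈? I
    ... | yes _  = refl
    ... | no v∉I = contradiction v∈I v∉I

    parent′-just : ∀ {u} v → parent′ v ≡ just u →
                   (parent v ≡ just u × v ∈ˢ I) ⊎ (call u ≡ just v)
    parent′-just v eq with v ∈? I
    ... | yes v∈I = inj₁ (eq , v∈I)
    ... | no  _   = inj₂ (caller-just eq)

    parent′-old : ∀ {u} v → parent′ v ≡ just u → u ∈ˢ I
    parent′-old v eq with parent′-just v eq
    ... | inj₁ (p , _) = parent-informed p
    ... | inj₂ c       = proj₁ (call-valid c)

    rank′-new : ∀ {v} → v ∉ I → rank′ v ≡ suc t
    rank′-new {v} v∉I with v ∈? I
    ... | yes v∈I = contradiction v∈I v∉I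
    ... | no _    = refl

    extend : BroadcastTree G s (suc t) J
    extend = record
      { parent          = parent′
      ; rank            = rank′
      ; parent-adj      = λ {_} {v} → adj′ v
      ; parent-informed = λ {u} {v} eq → Equivalence.from (informed u) (inj₁ (parent′-old v eq))
      ; rank-<          = λ {_} {v} → rank-<′ v
      ; rank-≤          = λ {v} → rank-≤′ v
      ; orphan          = λ {v} → orphan′ v
      ; children-≤      = children-≤′
      }
      where
      adj′ : ∀ {u} v → parent′ v ≡ just u → Adj G u v
      adj′ v eq with parent′-just v eq
      ... | inj₁ (p , _) = parent-adj p
      ... | inj₂ c       = proj₂ (proj₂ (call-valid c))

      rank-<′ : ∀ {u} v → parent′ v ≡ just u → rank′ u < rank′ v
      rank-<′ v eq with parent′-just v eq
      ... | inj₁ (p , v∈I) =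
        subst₂ _<_ (sym (rank′-old (parent′-old v eq))) (sym (rank′-old v∈I)) (rank-< p)
      -- The caller was informed before this round, so its rank is at most `t`, while the vertex
      -- called has rank `suc t`.
      ... | inj₂ c =
        subst₂ _<_ (sym (rank′-old (parent′-old v eq))) (sym (rank′-new (proj₁ (proj₂ (call-valid c)))))
          (s≤s (rank-≤ (parent′-old v eq)))

      rank-≤′ : ∀ v → v ∈ˢ J → rank′ v ≤ suc t
      rank-≤′ v _ with v ∈? I
      ... | yes v∈I = m≤n⇒m≤1+n (rank-≤ v∈I)
      ... | no  _   = ≤-refl

      orphan′ : ∀ v → v ∈ˢ J → parent′ v ≡ nothing → v ≡ s
      orphan′ v v∈J eq with v ∈? I
      ... | yes v∈I = orphan v∈I eq
      ... | no  v∉I with Equivalence.to (informed v) v∈J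
      ...   | inj₁ v∈I     = contradiction v∈I v∉I
      ...   | inj₂ (_ , c) = contradiction c (caller-nothing eq)

      isCalledBy? : ∀ u → Decidable (λ v → call u ≡ just v)
      isCalledBy? u v = Maybe.≡-dec _≟_ (call u) (just v)

      children-≤′ : ∀ u {vs} → Unique vs → count (isChildOf? parent′ u) vs ≤ suc t
      children-≤′ u {vs} vs! = begin
        count (isChildOf? parent′ u) vs
          ≤⟨ count-⊎ _ (isChildOf? parent u) (isCalledBy? u)
               (λ {v} eq → Sum.map₁ proj₁ (parent′-just v eq)) vs ⟩
        count (isChildOf? parent u) vs + count (isCalledBy? u) vs
          -- `call u` is a single value, so the round adds at most one child.
          ≤⟨ +-mono-≤ (children-≤ u vs!)
               (count-subsingleton (isCalledBy? u)
                 (λ c d → Maybe.just-injective (trans (sym c) d)) vs!) ⟩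
        t + 1 ≡⟨ +-comm t 1 ⟩
        suc t ∎
        where open ≤-Reasoning

  broadcastTree : ∀ {t I} → Reachable G s t I → BroadcastTree G s t I
  broadcastTree start = record
    { parent          = λ _ → nothing
    ; rank            = λ _ → 0
    ; parent-adj      = λ ()
    ; parent-informed = λ ()
    ; rank-<          = λ ()
    ; rank-≤          = λ _ → z≤n
    ; orphan          = λ v∈ _ → x∈⁅y⁆⇒x≡y s v∈
    ; children-≤      = λ u {vs} _ → ≤-reflexive (cong length
        (filter-none (isChildOf? (λ _ → nothing) u) (All.universal (λ _ ()) vs)))
    }
  broadcastTree (step r R) = Extend.extend (broadcastTree r) R

  reachable-zero : ∀ {I} → Reachable G s 0 I → I ≡ ⁅ s ⁆
  reachable-zero start = refl

-- Geometric sums 1 + q + ... + q^(h - 1), in Horner form.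

geometricSum : ℕ → ℕ → ℕ
geometricSum q zero    = 0
geometricSum q (suc h) = suc (q * geometricSum q h)

geometricSum-mono : ∀ q {h k} → h ≤ k → geometricSum q h ≤ geometricSum q k
geometricSum-mono q z≤n       = z≤n
geometricSum-mono q (s≤s h≤k) = s≤s (*-monoʳ-≤ q (geometricSum-mono q h≤k))

-- Strictness carries the induction: it gives q · (sum + 1) ≤ q^(h + 1), and the spare q ≥ 2 pays
-- for the new summand 1 and for strictness again.
geometricSum<^ : ∀ {q} → 2 ≤ q → ∀ h → geometricSum q h < q ^ h
geometricSum<^ 2≤q zero = s≤s z≤n
geometricSum<^ {q} 2≤q (suc h) = begin
  2 + q * geometricSum q h   ≤⟨ +-monoˡ-≤ _ 2≤q ⟩
  q + q * geometricSum q h   ≡⟨ *-suc q _ ⟨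
  q * suc (geometricSum q h) ≤⟨ *-monoʳ-≤ q (geometricSum<^ 2≤q h) ⟩
  q * q ^ h                  ∎
  where open ≤-Reasoning

-- Arithmetic of adding a root in the size bound. One entry already pays for the root and for the b
-- new entries; each further one only adds 1 + b · g to the slack.
1+[e+b]*g≤e*[1+[1+b]*g] : ∀ {e} b g → 1 ≤ e → 1 + (e + b) * g ≤ e * suc (suc b * g)
1+[e+b]*g≤e*[1+[1+b]*g] {suc e} b g _ =
  ≤-trans (m≤m+n _ (e * (1 + b * g))) (≤-reflexive (identity e b g))
  where
  identity : ∀ e b g → (1 + ((1 + e) + b) * g) + e * (1 + b * g) ≡ (1 + e) * (1 + (1 + b) * g)
  identity = solve-∀

-- Entries of subtrees and the size bound.

module _ {n} (parent : Fin n → Maybe (Fin n)) where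
  open DecMembership (_≟_ {n}) using () renaming (_∈?_ to _∈ᴸ?_)

  -- For a subtree P is the list of strict ancestors of its root, so that an entry
  -- of the subtree is a vertex in it with no parent or with its parent in P.
  Entry : List (Fin n) → Fin n → Set
  Entry P v = Maybe.All (_∈ P) (parent v)

  entry? : ∀ P → Decidable (Entry P)
  entry? P v = Maybe.dec (_∈ᴸ? P) (parent v)

  entry-∷ : ∀ {x P v} → Entry (x ∷ P) v → Entry P v ⊎ parent v ≡ just x
  entry-∷ {v = v} e with parent v | e
  ... | nothing | _                       = inj₁ Maybe.nothing
  ... | just _  | Maybe.just (here refl)  = inj₂ refl
  ... | just _  | Maybe.just (there u∈P)  = inj₁ (Maybe.just u∈P)

  -- The invariant passed down to subtrees: a parent lies above the subtree, in `P`, or inside it.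
  -- This is all that the induction takes from the elimination tree.
  ParentsComparable : List (Fin n) → RootedTree (Fin n) → Set
  ParentsComparable P T = ∀ {u v} → v ∈ vertices T → parent v ≡ just u →
    u ∈ P ⊎ Ancestor u v T ⊎ Ancestor v u T

  ParentsComparableˢ : List (Fin n) → List (RootedTree (Fin n)) → Set
  ParentsComparableˢ P ts = ∀ {u v} → v ∈ verticesˢ ts → parent v ≡ just u →
    u ∈ P ⊎ Any (Ancestor u v) ts ⊎ Any (Ancestor v u) ts

  -- If the root is the ancestor `u`, then `u` is now in `x ∷ P`; it cannot be the ancestor `v`,
  -- since `x` does not recur below itself.
  comparable-children : ∀ {P x ts} → Unique (x ∷ verticesˢ ts) →
    ParentsComparable P (node x ts) → ParentsComparableˢ (x ∷ P) ts
  comparable-children (x∉ ∷ _) comp v∈ eq with comp (there v∈) eq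
  ... | inj₁ u∈P                = inj₁ (there u∈P)
  ... | inj₂ (inj₁ (root _))    = inj₁ (here refl)
  ... | inj₂ (inj₁ (below as))  = inj₂ (inj₁ as)
  ... | inj₂ (inj₂ (root _))    = contradiction refl (All.lookup x∉ v∈)
  ... | inj₂ (inj₂ (below as))  = inj₂ (inj₂ as)

  -- Sibling subtrees are disjoint, so a subtree in which `v` is comparable to its parent is the one
  -- containing `v`.
  comparable-head : ∀ {P t ts} → (∀ {x} → x ∈ vertices t → ¬ x ∈ verticesˢ ts) →
    ParentsComparableˢ P (t ∷ ts) → ParentsComparable P t
  comparable-head disj comp v∈ eq with comp (∈-++⁺ˡ v∈) eq
  ... | inj₁ u∈P               = inj₁ u∈P
  ... | inj₂ (inj₁ (here a))   = inj₂ (inj₁ a)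
  ... | inj₂ (inj₁ (there as)) = contradiction (descendant-∈ˢ as) (disj v∈)
  ... | inj₂ (inj₂ (here a))   = inj₂ (inj₂ a)
  ... | inj₂ (inj₂ (there as)) = contradiction (ancestor-∈ˢ as) (disj v∈)

  comparable-tail : ∀ {P t ts} → (∀ {x} → x ∈ vertices t → ¬ x ∈ verticesˢ ts) →
    ParentsComparableˢ P (t ∷ ts) → ParentsComparableˢ P ts
  comparable-tail {t = t} disj comp v∈ eq with comp (∈-++⁺ʳ (vertices t) v∈) eq
  ... | inj₁ u∈P               = inj₁ u∈P
  ... | inj₂ (inj₁ (there as)) = inj₂ (inj₁ as)
  ... | inj₂ (inj₁ (here a))   = contradiction v∈ (disj (descendant-∈ a))
  ... | inj₂ (inj₂ (there as)) = inj₂ (inj₂ as)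
  ... | inj₂ (inj₂ (here a))   = contradiction v∈ (disj (ancestor-∈ a))

  module _ (rank : Fin n → ℕ) (rank-< : ∀ {u v} → parent v ≡ just u → rank u < rank v) where

    -- Follow parents from `v`: a parent not in `P` is again a vertex of `T`, and the ranks
    -- decrease, so the walk stops at an entry.
    entry-exists : ∀ {P T} → ParentsComparable P T → ∀ {v} → Acc _<_ (rank v) →
                   v ∈ vertices T → ∃[ w ] (w ∈ vertices T × Entry P w)
    entry-exists {P} comp {v} (acc rs) v∈ with parent v in eq
    ... | nothing = v , v∈ , subst (Maybe.All (_∈ P)) (sym eq) Maybe.nothing
    ... | just u with comp v∈ eq
    ...   | inj₁ u∈P      = v , v∈ , subst (Maybe.All (_∈ P)) (sym eq) (Maybe.just u∈P)
    ...   | inj₂ (inj₁ a) = entry-exists comp (rs (rank-< eq)) (ancestor-∈ a)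
    ...   | inj₂ (inj₂ a) = entry-exists comp (rs (rank-< eq)) (descendant-∈ a)

    module _ {b : ℕ} (children-≤ : ∀ u {vs} → Unique vs → count (isChildOf? parent u) vs ≤ b) where
      open ≤-Reasoning

      -- Mutual induction on trees and forests. The trees of a forest share the same `P`, so their
      -- numbers of entries add up.
      size-≤ : ∀ P T → Unique (vertices T) → ParentsComparable P T →
        length (vertices T) ≤ count (entry? P) (vertices T) * geometricSum (suc b) (height T)
      sizeˢ-≤ : ∀ P ts → Unique (verticesˢ ts) → ParentsComparableˢ P ts →
        length (verticesˢ ts) ≤ count (entry? P) (verticesˢ ts) * geometricSum (suc b) (heightˢ ts)

      size-≤ P T@(node x ts) T!@(_ ∷ ts!) comp = begin
        1 + length (verticesˢ ts)
          ≤⟨ s≤s (sizeˢ-≤ (x ∷ P) ts ts! (comparable-children T! comp)) ⟩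
        1 + count (entry? (x ∷ P)) (verticesˢ ts) * g
          ≤⟨ s≤s (*-monoˡ-≤ g entries-≤) ⟩
        1 + (count (entry? P) (vertices T) + b) * g
          ≤⟨ 1+[e+b]*g≤e*[1+[1+b]*g] b g 1≤entries ⟩
        count (entry? P) (vertices T) * suc (suc b * g) ∎
        where
        g : ℕ
        g = geometricSum (suc b) (heightˢ ts)

        1≤entries : 1 ≤ count (entry? P) (vertices T)
        1≤entries with entry-exists comp (<-wellFounded (rank x)) (here refl)
        ... | w , w∈ , e = filter-some (entry? P) (lose w∈ e)

        entries-≤ : count (entry? (x ∷ P)) (verticesˢ ts) ≤ count (entry? P) (vertices T) + b
        entries-≤ = ≤-trans
          (count-⊎ (entry? (x ∷ P)) (entry? P) (isChildOf? parent x) entry-∷ (verticesˢ ts))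
          (+-mono-≤ (count-∷-≤ (entry? P) x (verticesˢ ts)) (children-≤ x ts!))

      sizeˢ-≤ P []       _   _    = z≤n
      sizeˢ-≤ P (t ∷ ts) ts! comp with Unique-++⁻ (vertices t) ts!
      ... | t! , ts!′ , disj = begin
        length (vertices t ++ verticesˢ ts)
          ≡⟨ length-++ (vertices t) ⟩
        length (vertices t) + length (verticesˢ ts)
          ≤⟨ +-mono-≤ (size-≤ P t t! (comparable-head disj comp))
                      (sizeˢ-≤ P ts ts!′ (comparable-tail disj comp)) ⟩
        e₁ * geometricSum (suc b) (height t) + e₂ * geometricSum (suc b) (heightˢ ts)
          -- Both sums are extended to the larger height to obtain a common factor.
          ≤⟨ +-mono-≤ (*-monoʳ-≤ e₁ (geometricSum-mono (suc b) (m≤m⊔n _ _)))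
                      (*-monoʳ-≤ e₂ (geometricSum-mono (suc b) (m≤n⊔m (height t) _))) ⟩
        e₁ * g + e₂ * g
          ≡⟨ *-distribʳ-+ g e₁ e₂ ⟨
        (e₁ + e₂) * g
          ≡⟨ cong (_* g) (count-++ (entry? P) (vertices t) (verticesˢ ts)) ⟨
        count (entry? P) (vertices t ++ verticesˢ ts) * g ∎
        where
        e₁ e₂ g : ℕ
        e₁ = count (entry? P) (vertices t)
        e₂ = count (entry? P) (verticesˢ ts)
        g  = geometricSum (suc b) (height t ⊔ heightˢ ts)

-- From the size bound to the broadcast time.

order-≤-geometricSum : ∀ {n} {G : Graph n} {T} → IsTreeDepthTree G T →
  ∀ {s b} → BroadcastsIn G s b → n ≤ geometricSum (suc b) (height T)
order-≤-geometricSum {n} {G} {T} isTDT {s} {b} r = begin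
  n                                     ≡⟨ length-tabulate {n = n} (λ i → i) ⟨
  length (allFin n)           ≡⟨ ↭-length spanning ⟨
  length (vertices T)
    ≤⟨ size-≤ parent rank rank-< children-≤ [] T T! (λ _ eq → inj₂ (comparable (parent-adj eq))) ⟩
  count (entry? parent []) (vertices T) * g
    -- With `P` empty an entry has no parent; as all vertices are informed, it must be `s`.
    ≤⟨ *-monoˡ-≤ g (count-subsingleton (entry? parent [])
         (λ e e′ → trans (entry≡s e) (sym (entry≡s e′))) T!) ⟩
  1 * g                                 ≡⟨ *-identityˡ g ⟩
  g                                     ∎
  where
  open ≤-Reasoning
  open IsTreeDepthTree isTDT
  open BroadcastTree (broadcastTree r)
  g : ℕ
  g = geometricSum (suc b) (height T)

  T! : Unique (vertices T)
  T! = PermutationSetoid.Unique-resp-↭ (setoid (Fin n))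
         (↭⇒↭ₛ (↭-sym spanning)) (allFin⁺ n)

  entry≡s : ∀ {v} → Entry parent [] v → v ≡ s
  entry≡s {v} e with parent v in eq | e
  ... | nothing | _              = orphan ∈⊤ eq
  ... | just _  | Maybe.just ()

-- For d ≥ 2 the sum is below (1 + b)^d, and 1 + b ≤ d · b. The latter fails for d = 1, where the
-- sum is just 1.
geometricSum-≤-[*]^ : ∀ {b} → 1 ≤ b → ∀ d → geometricSum (suc b) d ≤ (d * b) ^ d
geometricSum-≤-[*]^ 1≤b zero          = z≤n
geometricSum-≤-[*]^ {b} 1≤b (suc zero) = begin
  suc (b * 0)     ≡⟨ cong suc (*-zeroʳ b) ⟩
  1               ≤⟨ 1≤b ⟩
  b               ≡⟨ *-identityˡ b ⟨
  1 * b           ≡⟨ *-identityʳ (1 * b) ⟨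
  (1 * b) ^ 1     ∎
  where open ≤-Reasoning
geometricSum-≤-[*]^ {b} 1≤b d@(suc (suc k)) = begin
  geometricSum (suc b) d ≤⟨ <⇒≤ (geometricSum<^ (s≤s 1≤b) d) ⟩
  suc b ^ d              ≤⟨ ^-monoˡ-≤ d (+-mono-≤ 1≤b (m≤m+n b (k * b))) ⟩
  (d * b) ^ d            ∎
  where open ≤-Reasoning

-- After zero rounds only `s` is informed, but there are two distinct vertices.
broadcast-positive : ∀ {n} {G : Graph n} → 1 < n → ∀ {s b} → BroadcastsIn G s b → 1 ≤ b
broadcast-positive {n = suc (suc _)} 1<n {b = suc _} r = s≤s z≤n
broadcast-positive {n = suc (suc _)} 1<n {s} {b = zero} r =
  contradiction (trans (≡s zero) (sym (≡s (suc zero)))) λ ()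
  where
  ≡s : ∀ v → v ≡ s
  ≡s v = x∈⁅y⁆⇒x≡y s (subst (v ∈ˢ_) (reachable-zero r) ∈⊤)
broadcast-positive {n = suc zero} (s≤s ())

-- The root and the division are cleared: `n ≤ (td * b) ^ td` is the claimed bound multiplied by
-- `td` and raised to the power `td`.
theorem33 : ∀ (n : ℕ) (G : Graph n) → Connected G → 1 < n →
    ∀ (td : ℕ) → IsTreeDepth G td →
    ∀ (s : Fin n) (b : ℕ) → IsBroadcastTime G s b →
    n ≤ (td * b) ^ td
theorem33 n G conn 1<n td ((T , isTDT , refl) , _) s b (r , _) =
  ≤-trans (order-≤-geometricSum isTDT r) (geometricSum-≤-[*]^ (broadcast-positive 1<n r) td)
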